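{- The Skolem Conjecture holds if and only if the following statement (S') holds: (S') Let $b$ be a nonzero integer and let $\mathbf u=\langle u_n\rangle_{n\in\mathbb Z}$ be a simple rational LRBS taking values in $\mathbb Z[\frac1b]$. Then $\mathbf u$ has no integer zero if and only if there exist an integer $N\ge1$ and primes $p_1,\dots,p_t$ coprime to $b$ with the following property: for every $\ell\in\{0,\dots,N-1\}$ there is an $i$ such that the sequence $\langle u_{Nn+\ell}\rangle_{n\in\mathbb Z}$ has no $p_i$-adic zero.
   Context: A rational linear recurrent bi-sequence (LRBS) is a bi-infinite sequence $\langle u_n\rangle_{n\in\mathbb Z}$ of rationals satisfying $u_{n+d}=a_{d-1}u_{n+d-1}+\dots+a_0u_n$ for all $n\in\mathbb Z$, with rational $a_i$ and $a_0\neq0$. It is simple if the characteristic polynomial of its minimal-order recurrence has no repeated roots. An integer zero is an $n\in\mathbb Z$ with $u_n=0$. For a prime $p$ not dividing $b$ and a sequence $\langle w_n\rangle_{n\in\mathbb Z}$ with values in $\mathbb Z[\frac1b]$, a $p$-adic zero of $\mathbf w$ is an $x\in\mathbb Z_p$ for which there exist integers $n_1,n_2,\dots$ with $v_p(w_{n_r})\ge r$ and $n_r\equiv x \pmod{p^r\mathbb Z_p}$ for all $r\ge1$. Skolem Conjecture: for every nonzero integer $b$ and every simple rational LRBS $\mathbf u$ with values in $\mathbb Z[\frac1b]$, $\mathbf u$ has no integer zero if and only if there is an integer $m\ge2$ with $\gcd(b,m)=1$ such that $u_n\not\equiv0\pmod m$ for all $n\in\mathbb Z$. -}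

module Defs where

open import Level using (0ℓ)
open import Algebra.Apartness.Bundles using (HeytingCommutativeRing; HeytingField)
open import Algebra.Bundles using (CommutativeRing)
open import Algebra.Morphism.Structures using (IsRingHomomorphism)
import Algebra.Properties.CommutativeMonoid.Sum as Sum
open import Data.Fin.Base using (Fin; zero; toℕ)
open import Data.Integer.Base as ℤ using (ℤ; +_; 0ℤ; 1ℤ)
open import Data.Integer.Divisibility.Signed using (_∣_; divides; ∣n⇒∣m*n; ∣m∣n⇒∣m-n)
import Data.Integer.GCD as ℤ
open import Data.Integer.Solver using (module +-*-Solver)
open import Data.List.Base as List using (List; []; _∷_; _++_)
open import Data.Nat.Base as ℕ using (ℕ)
open import Data.Product.Base using (∃; ∃-syntax; Σ-syntax; _×_)
open import Data.Rational.Base as ℚ using (ℚ; 0ℚ; 1ℚ; _/_; ↥_; ↧_)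
open import Data.Rational.Properties using (+-0-commutativeMonoid)
open import Data.Sum.Base using (_⊎_)
open import Function.Bundles using (_⇔_)
open import Relation.Binary.PropositionalEquality using (_≡_; _≢_; refl; subst)
open import Relation.Nullary.Negation using (¬_)

open Sum +-0-commutativeMonoid using (sum)

-- A polynomial is its list of coefficients, constant term first; trailing zero
-- coefficients are allowed, so polynomials are compared coefficientwise by _≈ₚ_.
module Polynomial (R : CommutativeRing 0ℓ 0ℓ) where
  open CommutativeRing R

  Poly : Set
  Poly = List Carrier

  coeff : Poly → ℕ → Carrier
  coeff []      _         = 0#
  coeff (a ∷ _) ℕ.zero    = a
  coeff (_ ∷ f) (ℕ.suc i) = coeff f i

  infix 4 _≈ₚ_
  _≈ₚ_ : Poly → Poly → Set
  f ≈ₚ g = ∀ i → coeff f i ≈ coeff g i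

  infixl 6 _+ₚ_
  _+ₚ_ : Poly → Poly → Poly
  []      +ₚ g       = g
  (a ∷ f) +ₚ []      = a ∷ f
  (a ∷ f) +ₚ (b ∷ g) = a + b ∷ f +ₚ g

  infixl 7 _*ₚ_
  _*ₚ_ : Poly → Poly → Poly
  []      *ₚ g = []
  (a ∷ f) *ₚ g = List.map (a *_) g +ₚ (0# ∷ f *ₚ g)

  X-_ : Carrier → Poly
  X- x = - x ∷ 1# ∷ []

  IsRepeatedRoot : Poly → Carrier → Set
  IsRepeatedRoot f x = ∃[ g ] f ≈ₚ (X- x) *ₚ (X- x) *ₚ g

-- u (n + d) = a_{d-1} u (n + d - 1) + ⋯ + a₀ u n with d = suc pred-order and
-- aᵢ = coeffs i.
record Recurrence : Set where
  field
    pred-order : ℕ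
  order : ℕ
  order = ℕ.suc pred-order
  field
    coeffs : Fin order → ℚ
    a₀≢0   : coeffs zero ≢ 0ℚ

  Holds : (ℤ → ℚ) → Set
  Holds u = ∀ n → u (n ℤ.+ + order) ≡ sum (λ i → coeffs i ℚ.* u (n ℤ.+ + toℕ i))

  charPoly : List ℚ
  charPoly = List.tabulate (λ i → ℚ.- coeffs i) ++ 1ℚ ∷ []

open Recurrence public

IsLRBS : (ℤ → ℚ) → Set
IsLRBS u = ∃[ R ] Holds R u

IsMinimalFor : (ℤ → ℚ) → Recurrence → Set
IsMinimalFor u R = Holds R u × (∀ S → Holds S u → order R ℕ.≤ order S)

-- The library has no algebraic closure, so roots are taken in arbitrary field
-- extensions φ : ℚ → K.  For K with decidable equality (in particular for any K
-- in the presence of excluded middle) a Heyting field is a field in the usual sense.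
HasNoRepeatedRoots : List ℚ → Set₁
HasNoRepeatedRoots f =
  ∀ (K : HeytingField 0ℓ 0ℓ 0ℓ) →
  let R = HeytingCommutativeRing.commutativeRing (HeytingField.heytingCommutativeRing K)
      open CommutativeRing R using (Carrier; rawRing)
      open Polynomial R using (IsRepeatedRoot)
  in (φ : ℚ → Carrier) → IsRingHomomorphism ℚ.+-*-rawRing rawRing φ →
     ∀ x → ¬ IsRepeatedRoot (List.map φ f) x

-- The minimal-order recurrence is unique unless u = 0; in that case the minimal
-- ones have order 1 and none of their characteristic polynomials has a repeated root.
IsSimple : (ℤ → ℚ) → Set₁
IsSimple u = ∃[ R ] IsMinimalFor u R × HasNoRepeatedRoots (charPoly R)

HasIntegerZero : (ℤ → ℚ) → Set
HasIntegerZero u = ∃[ n ] u n ≡ 0ℚ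

infix 4 _∈ℤ[1/_] _≡0mod_inℤ[1/_]
_∈ℤ[1/_] : ℚ → ℤ → Set
q ∈ℤ[1/ b ] = ∃[ k ] ∃[ z ] (b ℤ.^ k / 1) ℚ.* q ≡ z / 1

_≡0mod_inℤ[1/_] : ℚ → ℕ → ℤ → Set
q ≡0mod m inℤ[1/ b ] = ∃[ r ] r ∈ℤ[1/ b ] × q ≡ (+ m / 1) ℚ.* r

SkolemConjecture : Set₁
SkolemConjecture =
  ∀ (b : ℤ) → b ≢ 0ℤ →
  ∀ (u : ℤ → ℚ) → IsLRBS u → IsSimple u → (∀ n → u n ∈ℤ[1/ b ]) →
  (¬ HasIntegerZero u) ⇔
  (∃[ m ] 2 ℕ.≤ m × ℤ.gcd b (+ m) ≡ 1ℤ × (∀ n → ¬ (u n ≡0mod m inℤ[1/ b ])))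

IntegerValuation : ℕ → ℤ → ℕ → Set
IntegerValuation p z k = (+ p) ℤ.^ k ∣ z × ¬ ((+ p) ℤ.^ (ℕ.suc k) ∣ z)

-- v_p(q) = e, for q ≠ 0.
Valuation : ℕ → ℚ → ℤ → Set
Valuation p q e =
  ∃[ i ] ∃[ j ] IntegerValuation p (↥ q) i × IntegerValuation p (↧ q) j × e ≡ + i ℤ.- + j

-- v_p(q) ≥ r, with v_p(0) = ∞.
Valuation≥ : ℕ → ℚ → ℤ → Set
Valuation≥ p q r = q ≡ 0ℚ ⊎ (∃[ e ] Valuation p q e × r ℤ.≤ e)

-- ℤₚ p is the inverse limit of the rings ℤ/pʳ, an element of ℤ/pʳ being given
-- by an integer representative; equality of p-adic integers is _≈ᵖ_.
record ℤₚ (p : ℕ) : Set where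
  field
    residue  : ℕ → ℤ
    coherent : ∀ r → (+ p) ℤ.^ r ∣ residue (ℕ.suc r) ℤ.- residue r

open ℤₚ public

module _ {p : ℕ} where
  open +-*-Solver

  infix 4 _≈ᵖ_
  _≈ᵖ_ : ℤₚ p → ℤₚ p → Set
  x ≈ᵖ y = ∀ r → (+ p) ℤ.^ r ∣ residue x r ℤ.- residue y r

  fromℤ : ℤ → ℤₚ p
  fromℤ n .residue _  = n
  fromℤ n .coherent r =
    divides 0ℤ (solve 1 (λ a → a :- a := con 0ℤ) refl n)

  infixl 6 _-ᵖ_
  _-ᵖ_ : ℤₚ p → ℤₚ p → ℤₚ p
  (x -ᵖ y) .residue r  = residue x r ℤ.- residue y r
  (x -ᵖ y) .coherent r =
    subst ((+ p) ℤ.^ r ∣_)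
      (solve 4 (λ a b c d → (a :- b) :- (c :- d) := (a :- c) :- (b :- d)) refl
        (residue x (ℕ.suc r)) (residue x r) (residue y (ℕ.suc r)) (residue y r))
      (∣m∣n⇒∣m-n (coherent x r) (coherent y r))

  infixr 7 _·ᵖ_
  _·ᵖ_ : ℤ → ℤₚ p → ℤₚ p
  (c ·ᵖ x) .residue r  = c ℤ.* residue x r
  (c ·ᵖ x) .coherent r =
    subst ((+ p) ℤ.^ r ∣_)
      (solve 3 (λ c a b → c :* (a :- b) := c :* a :- c :* b) refl
        c (residue x (ℕ.suc r)) (residue x r))
      (∣n⇒∣m*n c (coherent x r))

  infix 4 _≡ᵖ_mod-pow_
  _≡ᵖ_mod-pow_ : ℤₚ p → ℤₚ p → ℕ → Set
  x ≡ᵖ y mod-pow r = ∃[ z ] x -ᵖ y ≈ᵖ ((+ p) ℤ.^ r) ·ᵖ z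

IsPadicZero : (p : ℕ) → (ℤ → ℚ) → ℤₚ p → Set
IsPadicZero p w x =
  Σ[ n ∈ (ℕ → ℤ) ] (∀ r → 1 ℕ.≤ r → Valuation≥ p (w (n r)) (+ r) × fromℤ (n r) ≡ᵖ x mod-pow r)

HasPadicZero : ℕ → (ℤ → ℚ) → Set
HasPadicZero p w = ∃ (IsPadicZero p w)

{-# OPTIONS --safe #-}

-- The two local conditions are compared for each sequence u separately, at the
-- cost of changing b in one direction.
--
-- If w has no p-adic zero then v_p(w n) is bounded, because ℤₚ is compact; hence
-- the product over ℓ of suitable powers of the primes p_i(ℓ) is a modulus at
-- which u never vanishes.
--
-- Conversely, replace b by a multiple c over which all coefficients of the
-- recurrence and the inverse of a₀ become integral. The conjecture for c gives a
-- modulus m prime to c, modulo which u is determined in both directions by any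
-- window of consecutive values, hence is periodic, say of period N. For each ℓ
-- some prime power p^a divides m but not u ℓ, so it divides no u (N n + ℓ).
module Submission where

open import Defs
open import Level using (0ℓ)
open import Axiom.ExcludedMiddle using (ExcludedMiddle)
open import Data.Fin.Base using (Fin; zero; suc; toℕ; fromℕ<; funToFin; finToFun)
open import Data.Fin.Properties using (toℕ<n; toℕ-fromℕ<; pigeonhole; finToFun-funToFin)
open import Data.Integer.Base as ℤ using (ℤ; +_; -[1+_]; 0ℤ; 1ℤ; _+_; _-_; _*_; _^_; ∣_∣; +≤+)
open import Data.Integer.DivMod using (_%ℕ_; _/ℕ_; n%ℕd<d; a≡a%ℕn+[a/ℕn]*n)
open import Data.Integer.Divisibility.Signed
  using (_∣_; divides; ∣ᵤ⇒∣; ∣⇒∣ᵤ; ∣-refl; ∣-trans; ∣m⇒∣m*n; ∣n⇒∣m*n; ∣m∣n⇒∣m+n; ∣m∣n⇒∣m-n; *-cancelʳ-∣; *-monoˡ-∣)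
open import Data.Integer.GCD using (gcd)
import Data.Integer.Properties as ℤ
import Data.Integer.Solver as ℤ-Solver
open import Data.List.Base using ([]; _∷_)
open import Data.List.Relation.Unary.All using (_∷_)
open import Data.Nat.Base as ℕ using (ℕ; zero; suc; _≤_; _<_; s≤s; z≤n; NonZero)
open import Data.Nat.Coprimality as Coprimality
  using (Coprime; gcd≡1⇒coprime; coprime⇒gcd≡1; coprime-divisor; coprime-Bézout)
import Data.Nat.Divisibility as ℕ
import Data.Nat.GCD as ℕ
open import Data.Nat.Primality using (Prime; prime⇒nonZero; prime⇒nonTrivial; prime⇒irreducible)
open import Data.Nat.Primality.Factorisation using (factorise)
import Data.Nat.Properties as ℕ
open import Data.Product.Base using (∃; ∃-syntax; Σ-syntax; _×_; _,_; proj₁; proj₂)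
open import Data.Rational.Base as ℚ using (ℚ; 0ℚ; 1ℚ; _/_; ↥_; ↧_; toℚᵘ)
import Data.Rational.Properties as ℚ
import Data.Rational.Solver as ℚ-Solver
open import Data.Rational.Unnormalised.Base as ℚᵘ using (mkℚᵘ; *≡*)
import Data.Rational.Unnormalised.Properties as ℚᵘ
open import Data.Sum.Base using (inj₁; inj₂; [_,_]′)
import Data.Vec.Functional as Vector
open import Function.Base using (_∘_)
open import Function.Bundles using (_⇔_; mk⇔; Equivalence)
open import Relation.Binary.PropositionalEquality
  using (_≡_; _≢_; refl; sym; trans; cong; cong₂; subst; subst₂; module ≡-Reasoning)
open import Relation.Nullary.Decidable using (yes; no; decidable-stable)
open import Relation.Nullary.Negation using (¬_; contradiction)
open import Algebra.Properties.CommutativeMonoid.Sum ℚ.+-0-commutativeMonoid using (sum)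

-- Integers inside the rationals

module _ where
  open ℚᵘ.≃-Reasoning

  /1-homo-* : ∀ x y → (x * y) / 1 ≡ (x / 1) ℚ.* (y / 1)
  /1-homo-* x y = ℚ.toℚᵘ-injective (begin
    toℚᵘ ((x * y) / 1)             ≈⟨ ℚ.toℚᵘ-fromℚᵘ (mkℚᵘ (x * y) 0) ⟩
    mkℚᵘ x 0 ℚᵘ.* mkℚᵘ y 0         ≈⟨ ℚᵘ.*-cong (ℚ.toℚᵘ-fromℚᵘ (mkℚᵘ x 0)) (ℚ.toℚᵘ-fromℚᵘ (mkℚᵘ y 0)) ⟨
    toℚᵘ (x / 1) ℚᵘ.* toℚᵘ (y / 1) ≈⟨ ℚ.toℚᵘ-homo-* (x / 1) (y / 1) ⟨
    toℚᵘ ((x / 1) ℚ.* (y / 1))     ∎)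

  /1-homo-+ : ∀ x y → (x + y) / 1 ≡ (x / 1) ℚ.+ (y / 1)
  /1-homo-+ x y = ℚ.toℚᵘ-injective (begin
    toℚᵘ ((x + y) / 1)             ≈⟨ ℚ.toℚᵘ-fromℚᵘ (mkℚᵘ (x + y) 0) ⟩
    mkℚᵘ (x + y) 0                 ≡⟨ cong₂ (λ s t → mkℚᵘ (s + t) 0) (ℤ.*-identityʳ x) (ℤ.*-identityʳ y) ⟨
    mkℚᵘ x 0 ℚᵘ.+ mkℚᵘ y 0         ≈⟨ ℚᵘ.+-cong (ℚ.toℚᵘ-fromℚᵘ (mkℚᵘ x 0)) (ℚ.toℚᵘ-fromℚᵘ (mkℚᵘ y 0)) ⟨
    toℚᵘ (x / 1) ℚᵘ.+ toℚᵘ (y / 1) ≈⟨ ℚ.toℚᵘ-homo-+ (x / 1) (y / 1) ⟨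
    toℚᵘ ((x / 1) ℚ.+ (y / 1))     ∎)

  denominator-clears : ∀ q → (↧ q / 1) ℚ.* q ≡ ↥ q / 1
  denominator-clears q@record{} = ℚ.toℚᵘ-injective (begin
    toℚᵘ ((↧ q / 1) ℚ.* q)       ≈⟨ ℚ.toℚᵘ-homo-* (↧ q / 1) q ⟩
    toℚᵘ (↧ q / 1) ℚᵘ.* toℚᵘ q   ≈⟨ ℚᵘ.*-congʳ {toℚᵘ q} (ℚ.toℚᵘ-fromℚᵘ (mkℚᵘ (↧ q) 0)) ⟩
    mkℚᵘ (↧ q) 0 ℚᵘ.* toℚᵘ q     ≈⟨ *≡* (solve 2 (λ d n → (d :* n) :* con 1ℤ := n :* (con 1ℤ :* d)) refl (↧ q) (↥ q)) ⟩
    mkℚᵘ (↥ q) 0                 ≈⟨ ℚ.toℚᵘ-fromℚᵘ (mkℚᵘ (↥ q) 0) ⟨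
    toℚᵘ (↥ q / 1)               ∎)
    where open ℤ-Solver.+-*-Solver

/1-injective : ∀ {x y} → x / 1 ≡ y / 1 → x ≡ y
/1-injective {x} {y} eq with ℚ./-injective-≃ (mkℚᵘ x 0) (mkℚᵘ y 0) eq
... | *≡* x*1≡y*1 = trans (sym (ℤ.*-identityʳ x)) (trans x*1≡y*1 (ℤ.*-identityʳ y))

/1-nonZero : ∀ {x} → x ≢ 0ℤ → ℚ.NonZero (x / 1)
/1-nonZero x≢0 = ℚ.≢-nonZero (x≢0 ∘ /1-injective)

*-cancelˡ-≡ : ∀ q {x y} .{{_ : ℚ.NonZero q}} → q ℚ.* x ≡ q ℚ.* y → x ≡ y
*-cancelˡ-≡ q {x} {y} eq = trans (sym (strip x)) (trans (cong (ℚ.1/ q ℚ.*_) eq) (strip y))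
  where
  strip : ∀ x → ℚ.1/ q ℚ.* (q ℚ.* x) ≡ x
  strip x = trans (sym (ℚ.*-assoc (ℚ.1/ q) q x))
                  (trans (cong (ℚ._* x) (ℚ.*-inverseˡ q)) (ℚ.*-identityˡ x))

-- Moves an equation between rationals to one between integers that involves the reduced numerator
-- and denominator, where divisibility arguments apply.
clear-fraction : ∀ x y q → (x / 1) ℚ.* q ≡ y / 1 → x * ↥ q ≡ y * ↧ q
clear-fraction x y q eq = /1-injective (begin
  (x * ↥ q) / 1                   ≡⟨ /1-homo-* x (↥ q) ⟩
  (x / 1) ℚ.* (↥ q / 1)           ≡⟨ cong ((x / 1) ℚ.*_) (denominator-clears q) ⟨
  (x / 1) ℚ.* ((↧ q / 1) ℚ.* q)   ≡⟨ solve 3 (λ a b c → a :* (b :* c) := (a :* c) :* b) refl (x / 1) (↧ q / 1) q ⟩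
  (x / 1) ℚ.* q ℚ.* (↧ q / 1)     ≡⟨ cong (ℚ._* (↧ q / 1)) eq ⟩
  (y / 1) ℚ.* (↧ q / 1)           ≡⟨ /1-homo-* y (↧ q) ⟨
  (y * ↧ q) / 1                   ∎)
  where
  open ≡-Reasoning
  open ℚ-Solver.+-*-Solver

-- The ring ℤ[1/b] and its ideals

module Localization (b : ℤ) where
  open ≡-Reasoning
  open ℚ-Solver.+-*-Solver

  private
    /1-^-+ : ∀ k j → (b ^ (k ℕ.+ j)) / 1 ≡ (b ^ k / 1) ℚ.* (b ^ j / 1)
    /1-^-+ k j = trans (cong (_/ 1) (ℤ.^-distribˡ-+-* b k j)) (/1-homo-* (b ^ k) (b ^ j))

  integer∈ : ∀ z → z / 1 ∈ℤ[1/ b ]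
  integer∈ z = 0 , z , ℚ.*-identityˡ (z / 1)

  +-∈ : ∀ {x y} → x ∈ℤ[1/ b ] → y ∈ℤ[1/ b ] → x ℚ.+ y ∈ℤ[1/ b ]
  +-∈ {x} {y} (k , z , bᵏx≡z) (j , w , bʲy≡w) = k ℕ.+ j , b ^ j * z + b ^ k * w , (begin
    (b ^ (k ℕ.+ j) / 1) ℚ.* (x ℚ.+ y)
      ≡⟨ cong (ℚ._* (x ℚ.+ y)) (/1-^-+ k j) ⟩
    B k ℚ.* B j ℚ.* (x ℚ.+ y)
      ≡⟨ solve 4 (λ a c x y → a :* c :* (x :+ y) := c :* (a :* x) :+ a :* (c :* y)) refl (B k) (B j) x y ⟩
    B j ℚ.* (B k ℚ.* x) ℚ.+ B k ℚ.* (B j ℚ.* y)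
      ≡⟨ cong₂ (λ s t → B j ℚ.* s ℚ.+ B k ℚ.* t) bᵏx≡z bʲy≡w ⟩
    B j ℚ.* (z / 1) ℚ.+ B k ℚ.* (w / 1)
      ≡⟨ cong₂ ℚ._+_ (/1-homo-* (b ^ j) z) (/1-homo-* (b ^ k) w) ⟨
    ((b ^ j * z) / 1) ℚ.+ ((b ^ k * w) / 1)
      ≡⟨ /1-homo-+ (b ^ j * z) (b ^ k * w) ⟨
    (b ^ j * z + b ^ k * w) / 1 ∎)
    where
    B : ℕ → ℚ
    B k = b ^ k / 1

  *-∈ : ∀ {x y} → x ∈ℤ[1/ b ] → y ∈ℤ[1/ b ] → x ℚ.* y ∈ℤ[1/ b ]
  *-∈ {x} {y} (k , z , bᵏx≡z) (j , w , bʲy≡w) = k ℕ.+ j , z * w , (begin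
    (b ^ (k ℕ.+ j) / 1) ℚ.* (x ℚ.* y)
      ≡⟨ cong (ℚ._* (x ℚ.* y)) (/1-^-+ k j) ⟩
    B k ℚ.* B j ℚ.* (x ℚ.* y)
      ≡⟨ solve 4 (λ a c x y → a :* c :* (x :* y) := (a :* x) :* (c :* y)) refl (B k) (B j) x y ⟩
    (B k ℚ.* x) ℚ.* (B j ℚ.* y)
      ≡⟨ cong₂ ℚ._*_ bᵏx≡z bʲy≡w ⟩
    (z / 1) ℚ.* (w / 1)
      ≡⟨ /1-homo-* z w ⟨
    (z * w) / 1 ∎)
    where
    B : ℕ → ℚ
    B k = b ^ k / 1

  module Ideal (m : ℕ) where

    0≡0mod : 0ℚ ≡0mod m inℤ[1/ b ]
    0≡0mod = 0ℚ , integer∈ 0ℤ , sym (ℚ.*-zeroʳ (+ m / 1))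

    +-≡0mod : ∀ {x y} → x ≡0mod m inℤ[1/ b ] → y ≡0mod m inℤ[1/ b ] → (x ℚ.+ y) ≡0mod m inℤ[1/ b ]
    +-≡0mod (r , r∈ , refl) (s , s∈ , refl) =
      r ℚ.+ s , +-∈ r∈ s∈ , sym (ℚ.*-distribˡ-+ (+ m / 1) r s)

    *-≡0mod : ∀ {c x} → c ∈ℤ[1/ b ] → x ≡0mod m inℤ[1/ b ] → (c ℚ.* x) ≡0mod m inℤ[1/ b ]
    *-≡0mod {c} c∈ (r , r∈ , refl) =
      c ℚ.* r , *-∈ c∈ r∈ , solve 3 (λ c m r → c :* (m :* r) := m :* (c :* r)) refl c (+ m / 1) r

    neg-≡0mod : ∀ {x} → x ≡0mod m inℤ[1/ b ] → (ℚ.- x) ≡0mod m inℤ[1/ b ]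
    neg-≡0mod {x} x≡0 = subst (_≡0mod m inℤ[1/ b ]) (solve 1 (λ x → con (ℚ.- 1ℚ) :* x := :- x) refl x)
      (*-≡0mod (integer∈ (ℤ.- 1ℤ)) x≡0)

    sum-≡0mod : ∀ {n} (f g : Fin n → ℚ) →
                (∀ i → (f i ℚ.- g i) ≡0mod m inℤ[1/ b ]) → (sum f ℚ.- sum g) ≡0mod m inℤ[1/ b ]
    sum-≡0mod {zero}  f g f≡g = 0≡0mod
    sum-≡0mod {suc n} f g f≡g = subst (_≡0mod m inℤ[1/ b ])
      (solve 4 (λ x y s t → (x :- y) :+ (s :- t) := (x :+ s) :- (y :+ t)) refl
        (f zero) (g zero) (sum (f ∘ suc)) (sum (g ∘ suc)))
      (+-≡0mod (f≡g zero) (sum-≡0mod (f ∘ suc) (g ∘ suc) (f≡g ∘ suc)))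

  ≡0mod-∣ : ∀ {d m q} → d ℕ.∣ m → q ≡0mod m inℤ[1/ b ] → q ≡0mod d inℤ[1/ b ]
  ≡0mod-∣ {d} (ℕ.divides c refl) (r , r∈ , refl) =
    (+ c / 1) ℚ.* r , *-∈ (integer∈ (+ c)) r∈ , (begin
      (+ (c ℕ.* d) / 1) ℚ.* r               ≡⟨ cong (λ z → (z / 1) ℚ.* r) (ℤ.pos-* c d) ⟩
      ((+ c * + d) / 1) ℚ.* r               ≡⟨ cong (ℚ._* r) (/1-homo-* (+ c) (+ d)) ⟩
      (+ c / 1) ℚ.* (+ d / 1) ℚ.* r         ≡⟨ solve 3 (λ c d r → c :* d :* r := d :* (c :* r)) refl (+ c / 1) (+ d / 1) r ⟩
      (+ d / 1) ℚ.* ((+ c / 1) ℚ.* r)       ∎)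

  -- This is the integer `b ^ k * q` for the recorded exponent `k`, not the reduced numerator.
  -- Another exponent changes it by powers of `b`, which are units modulo any `m` prime to `b`.
  numerator : ∀ {q} → q ∈ℤ[1/ b ] → ℤ
  numerator (_ , z , _) = z

  -- The witness is the quotient of `q` by `m`, cleared by the same power of `b` as `q`.
  ∣⇒≡0mod : ∀ {m q} .{{_ : NonZero m}} (q∈ : q ∈ℤ[1/ b ]) → + m ∣ numerator q∈ → q ≡0mod m inℤ[1/ b ]
  ∣⇒≡0mod {m} {q} (k , _ , bᵏq≡z) (divides y refl) = m⁻¹ ℚ.* q , (k , y , *-cancelˡ-≡ (+ m / 1) (begin
      (+ m / 1) ℚ.* ((b ^ k / 1) ℚ.* (m⁻¹ ℚ.* q))
        ≡⟨ solve 4 (λ m a c q → m :* (a :* (c :* q)) := (m :* c) :* (a :* q)) refl (+ m / 1) (b ^ k / 1) m⁻¹ q ⟩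
      ((+ m / 1) ℚ.* m⁻¹) ℚ.* ((b ^ k / 1) ℚ.* q)
        ≡⟨ cong₂ ℚ._*_ (ℚ.*-inverseʳ (+ m / 1)) bᵏq≡z ⟩
      1ℚ ℚ.* ((y * + m) / 1)       ≡⟨ ℚ.*-identityˡ _ ⟩
      (y * + m) / 1                ≡⟨ cong (_/ 1) (ℤ.*-comm y (+ m)) ⟩
      (+ m * y) / 1                ≡⟨ /1-homo-* (+ m) y ⟩
      (+ m / 1) ℚ.* (y / 1)        ∎)) , (begin
    q                                ≡⟨ ℚ.*-identityˡ q ⟨
    1ℚ ℚ.* q                         ≡⟨ cong (ℚ._* q) (ℚ.*-inverseʳ (+ m / 1)) ⟨
    (+ m / 1) ℚ.* m⁻¹ ℚ.* q          ≡⟨ ℚ.*-assoc (+ m / 1) m⁻¹ q ⟩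
    (+ m / 1) ℚ.* (m⁻¹ ℚ.* q)        ∎)
    where
    instance
      m/1≢0 : ℚ.NonZero (+ m / 1)
      m/1≢0 = /1-nonZero (ℕ.≢-nonZero⁻¹ m ∘ ℤ.+-injective)
    m⁻¹ : ℚ
    m⁻¹ = ℚ.1/ (+ m / 1)

  -- The factors `b` are stripped one at a time by Euclid's lemma.
  coprime-^-cancel : ∀ {m z} → Coprime ∣ b ∣ ∣ m ∣ → ∀ k → m ∣ b ^ k * z → m ∣ z
  coprime-^-cancel {m} {z} c zero    m∣z = subst (m ∣_) (ℤ.*-identityˡ z) m∣z
  coprime-^-cancel {m} {z} c (suc k) m∣bbᵏz =
    coprime-^-cancel c k (∣ᵤ⇒∣ (coprime-divisor (Coprimality.sym c)
      (subst (∣ m ∣ ℕ.∣_) (trans (cong ∣_∣ (ℤ.*-assoc b (b ^ k) z)) (ℤ.abs-* b (b ^ k * z))) (∣⇒∣ᵤ m∣bbᵏz))))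

  -- If `b ^ j` clears the quotient of `q` by `m`, then `m` divides `b ^ j` times the numerator of
  -- `q`, and the power of `b` cancels.
  ≡0mod⇒∣ : ∀ {m q} → Coprime ∣ b ∣ m → (q∈ : q ∈ℤ[1/ b ]) → q ≡0mod m inℤ[1/ b ] → + m ∣ numerator q∈
  ≡0mod⇒∣ {m} c (k , z , bᵏq≡z) (r , (j , w , bʲr≡w) , refl) =
    coprime-^-cancel c j (divides (b ^ k * w) (/1-injective (begin
      (b ^ j * z) / 1                                     ≡⟨ /1-homo-* (b ^ j) z ⟩
      (b ^ j / 1) ℚ.* (z / 1)                             ≡⟨ cong ((b ^ j / 1) ℚ.*_) bᵏq≡z ⟨
      (b ^ j / 1) ℚ.* ((b ^ k / 1) ℚ.* ((+ m / 1) ℚ.* r)) ≡⟨ solve 4 (λ x y m r → x :* (y :* (m :* r)) := y :* (x :* r) :* m) refl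
                                                               (b ^ j / 1) (b ^ k / 1) (+ m / 1) r ⟩
      (b ^ k / 1) ℚ.* ((b ^ j / 1) ℚ.* r) ℚ.* (+ m / 1)   ≡⟨ cong (λ s → (b ^ k / 1) ℚ.* s ℚ.* (+ m / 1)) bʲr≡w ⟩
      (b ^ k / 1) ℚ.* (w / 1) ℚ.* (+ m / 1)               ≡⟨ cong (ℚ._* (+ m / 1)) (/1-homo-* (b ^ k) w) ⟨
      ((b ^ k * w) / 1) ℚ.* (+ m / 1)                     ≡⟨ /1-homo-* (b ^ k * w) (+ m) ⟨
      (b ^ k * w * + m) / 1                               ∎)))

∈-denominator : ∀ q → q ∈ℤ[1/ ↧ q ]
∈-denominator q = 1 , ↥ q ,
  trans (cong (λ d → (d / 1) ℚ.* q) (ℤ.*-identityʳ (↧ q))) (denominator-clears q)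

^-distrib-* : ∀ x y k → (x * y) ^ k ≡ x ^ k * y ^ k
^-distrib-* x y zero    = refl
^-distrib-* x y (suc k) = trans (cong (x * y *_) (^-distrib-* x y k))
  (solve 4 (λ x y s t → x :* y :* (s :* t) := (x :* s) :* (y :* t)) refl x y (x ^ k) (y ^ k))
  where open ℤ-Solver.+-*-Solver

∈-∣ : ∀ {b c q} → b ∣ c → q ∈ℤ[1/ b ] → q ∈ℤ[1/ c ]
∈-∣ {b} {q = q} (divides d refl) (k , z , bᵏq≡z) = k , d ^ k * z , (begin
  ((d * b) ^ k / 1) ℚ.* q               ≡⟨ cong (λ s → (s / 1) ℚ.* q) (^-distrib-* d b k) ⟩
  ((d ^ k * b ^ k) / 1) ℚ.* q           ≡⟨ cong (ℚ._* q) (/1-homo-* (d ^ k) (b ^ k)) ⟩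
  (d ^ k / 1) ℚ.* (b ^ k / 1) ℚ.* q     ≡⟨ ℚ.*-assoc (d ^ k / 1) (b ^ k / 1) q ⟩
  (d ^ k / 1) ℚ.* ((b ^ k / 1) ℚ.* q)   ≡⟨ cong ((d ^ k / 1) ℚ.*_) bᵏq≡z ⟩
  (d ^ k / 1) ℚ.* (z / 1)               ≡⟨ /1-homo-* (d ^ k) z ⟨
  (d ^ k * z) / 1                       ∎)
  where open ≡-Reasoning

-- Prime powers and valuations

-- A common divisor of `a` and `m ℕ.* n` is prime to `m`, as it divides `a`; hence it divides `n`.
coprime-* : ∀ {a m n} → Coprime a m → Coprime a n → Coprime a (m ℕ.* n)
coprime-* a⊥m a⊥n (d∣a , d∣mn) =
  a⊥n (d∣a , coprime-divisor (λ (e∣d , e∣m) → a⊥m (ℕ.∣-trans e∣d d∣a , e∣m)) d∣mn)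

coprime-^ : ∀ {a m} → Coprime a m → ∀ k → Coprime a (m ℕ.^ k)
coprime-^ a⊥m zero    = ℕ.∣1⇒≡1 ∘ proj₂
coprime-^ a⊥m (suc k) = coprime-* a⊥m (coprime-^ a⊥m k)

coprime-∣ʳ : ∀ {a m n} → m ℕ.∣ n → Coprime a n → Coprime a m
coprime-∣ʳ m∣n a⊥n (d∣a , d∣m) = a⊥n (d∣a , ℕ.∣-trans d∣m m∣n)

coprime-∣ˡ : ∀ {a b m} → a ℕ.∣ b → Coprime b m → Coprime a m
coprime-∣ˡ a∣b = Coprimality.sym ∘ coprime-∣ʳ a∣b ∘ Coprimality.sym

^-monoʳ-∣ : ∀ p {i j} → i ≤ j → p ℕ.^ i ℕ.∣ p ℕ.^ j
^-monoʳ-∣ p {i} {j} i≤j = subst (λ k → p ℕ.^ i ℕ.∣ p ℕ.^ k) (ℕ.m+[n∸m]≡n i≤j)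
  (subst (p ℕ.^ i ℕ.∣_) (sym (ℕ.^-distribˡ-+-* p i (j ℕ.∸ i))) (ℕ.m∣m*n (p ℕ.^ (j ℕ.∸ i))))

pos-^ : ∀ p k → + (p ℕ.^ k) ≡ (+ p) ^ k
pos-^ p zero    = refl
pos-^ p (suc k) = trans (ℤ.pos-* p (p ℕ.^ k)) (cong (+ p *_) (pos-^ p k))

^∣⇒^∣ᵤ : ∀ {p k z} → (+ p) ^ k ∣ z → p ℕ.^ k ℕ.∣ ∣ z ∣
^∣⇒^∣ᵤ {p} {k} {z} = subst (λ n → ∣ n ∣ ℕ.∣ ∣ z ∣) (sym (pos-^ p k)) ∘ ∣⇒∣ᵤ

^∣ᵤ⇒^∣ : ∀ {p k z} → p ℕ.^ k ℕ.∣ ∣ z ∣ → (+ p) ^ k ∣ z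
^∣ᵤ⇒^∣ {p} {k} {z} = subst (_∣ z) (pos-^ p k) ∘ ∣ᵤ⇒∣

m<n^m : ∀ {n} → 1 < n → ∀ m → m < n ℕ.^ m
m<n^m         1<n zero    = s≤s z≤n
m<n^m {n} 1<n (suc m) = begin-strict
  suc m               ≤⟨ m<n^m 1<n m ⟩
  n ℕ.^ m             <⟨ ℕ.m<m*n (n ℕ.^ m) n {{ℕ.>-nonZero (ℕ.≤-<-trans z≤n (m<n^m 1<n m))}} 1<n ⟩
  n ℕ.^ m ℕ.* n       ≡⟨ ℕ.*-comm (n ℕ.^ m) n ⟩
  n ℕ.^ suc m         ∎
  where open ℕ.≤-Reasoning

-- The exponent is searched for downwards from `n`, where divisibility fails because `n` is smaller
-- than its own exponential in base `p`.
exact-power : ∀ {p n} .{{_ : NonZero n}} → 1 < p → ∃[ k ] p ℕ.^ k ℕ.∣ n × ¬ p ℕ.^ suc k ℕ.∣ n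
exact-power {p} {n} 1<p = search n (λ pⁿ∣n → ℕ.<⇒≱ (m<n^m 1<p n) (ℕ.∣⇒≤ pⁿ∣n))
  where
  search : ∀ k → ¬ p ℕ.^ k ℕ.∣ n → ∃[ k ] p ℕ.^ k ℕ.∣ n × ¬ p ℕ.^ suc k ℕ.∣ n
  search zero    ¬1∣n = contradiction (ℕ.1∣ n) ¬1∣n
  search (suc k) ¬pᵏ⁺¹∣n with p ℕ.^ k ℕ.∣? n
  ... | yes pᵏ∣n = k , pᵏ∣n , ¬pᵏ⁺¹∣n
  ... | no ¬pᵏ∣n = search k ¬pᵏ∣n

prime⇒1< : ∀ {p} → Prime p → 1 < p
prime⇒1< {p} pp = ℕ.nonTrivial⇒n>1 p {{prime⇒nonTrivial pp}}

integerValuation : ∀ {p z} → Prime p → z ≢ 0ℤ → ∃[ k ] IntegerValuation p z k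
integerValuation {p} {z} pp z≢0
  with k , pᵏ∣z , ¬pᵏ⁺¹∣z ← exact-power {n = ∣ z ∣} {{ℕ.≢-nonZero (z≢0 ∘ ℤ.∣i∣≡0⇒i≡0)}} (prime⇒1< pp)
  = k , ^∣ᵤ⇒^∣ {k = k} pᵏ∣z , ¬pᵏ⁺¹∣z ∘ ^∣⇒^∣ᵤ {k = suc k}

∃-primeFactor : ∀ {n} .{{_ : NonZero n}} → n ≢ 1 → ∃[ p ] Prime p × p ℕ.∣ n
∃-primeFactor {n} n≢1 with factorise n
... | record { factors = []    ; isFactorisation = eq } = contradiction eq n≢1
... | record { factors = p ∷ ps ; isFactorisation = eq ; factorsPrime = pp ∷ _ } =
  p , pp , subst (p ℕ.∣_) (sym eq) (ℕ.m∣m*n _)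

-- Write `m = c * g` with `g` the gcd of `n` and `m`. Since `m` does not divide `n`, the cofactor
-- `c` has a prime factor `p`. If `a` is the exact exponent of `p` in `g`, then the power `suc a`
-- divides `m`, but it cannot divide `n` without dividing the gcd.
∤⇒∃-primePower : ∀ {m n} .{{_ : NonZero m}} → ¬ m ℕ.∣ n →
                 ∃[ p ] ∃[ a ] Prime p × p ℕ.^ suc a ℕ.∣ m × ¬ p ℕ.^ suc a ℕ.∣ n
∤⇒∃-primePower {m} {n} m∤n with ℕ.gcd[m,n]∣n n m
... | ℕ.divides c m≡c*g = p , a , pp , pᵃ⁺¹∣m , λ pᵃ⁺¹∣n → ¬pᵃ⁺¹∣g (ℕ.gcd-greatest pᵃ⁺¹∣n pᵃ⁺¹∣m)
  where
  g = ℕ.gcd n m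
  instance
    g≢0 : NonZero g
    g≢0 = ℕ.≢-nonZero (ℕ.gcd[m,n]≢0 n m (inj₂ (ℕ.≢-nonZero⁻¹ m)))
    c≢0 : NonZero c
    c≢0 = ℕ.≢-nonZero (λ c≡0 → ℕ.≢-nonZero⁻¹ m (trans m≡c*g (cong (ℕ._* g) c≡0)))
  c≢1 : c ≢ 1
  c≢1 c≡1 = m∤n (subst (ℕ._∣ n)
    (sym (trans m≡c*g (trans (cong (ℕ._* g) c≡1) (ℕ.*-identityˡ g)))) (ℕ.gcd[m,n]∣m n m))
  primeFactor = ∃-primeFactor c≢1
  p   = proj₁ primeFactor
  pp  = proj₁ (proj₂ primeFactor)
  p∣c = proj₂ (proj₂ primeFactor)
  power = exact-power {n = g} (prime⇒1< pp)
  a       = proj₁ power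
  pᵃ∣g    = proj₁ (proj₂ power)
  ¬pᵃ⁺¹∣g = proj₂ (proj₂ power)
  pᵃ⁺¹∣m : p ℕ.^ suc a ℕ.∣ m
  pᵃ⁺¹∣m = subst (p ℕ.^ suc a ℕ.∣_) (sym m≡c*g) (ℕ.*-pres-∣ p∣c pᵃ∣g)

-- The coprimality proof stored in a rational is irrelevant; `recompute` turns it into a usable one.
coprime-↥↧ : ∀ q → Coprime ∣ ↥ q ∣ ∣ ↧ q ∣
coprime-↥↧ (ℚ.mkℚ _ _ c) = Coprimality.recompute c

Valuation≥-antitone : ∀ {p q r s} → r ≤ s → Valuation≥ p q (+ s) → Valuation≥ p q (+ r)
Valuation≥-antitone r≤s (inj₁ q≡0)           = inj₁ q≡0
Valuation≥-antitone r≤s (inj₂ (e , v , s≤e)) = inj₂ (e , v , ℤ.≤-trans (+≤+ r≤s) s≤e)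

-- Divisibility by prime powers in ℤ[1/b] and p-adic valuations

module _ {b : ℤ} {p : ℕ} (pp : Prime p) (b⊥p : Coprime ∣ b ∣ p) where
  open Localization b

  ∤⇒coprime : ∀ {n} → ¬ p ℕ.∣ n → Coprime p n
  ∤⇒coprime p∤n {d} (d∣p , d∣n) with prime⇒irreducible pp d∣p
  ... | inj₁ d≡1  = d≡1
  ... | inj₂ refl = contradiction d∣n p∤n

  -- Clearing denominators gives `bᵏ↥q≡zpʳ↧q`. As `b` is prime to `p`, the power of `p` passes to
  -- `↥ q`. If `p` divided `↧ q`, the same equation would make it divide `↥ q`, against lowest
  -- terms; so the valuation of `q` is that of `↥ q`.
  ≡0mod⇒Valuation≥ : ∀ {q r} → q ≡0mod (p ℕ.^ r) inℤ[1/ b ] → Valuation≥ p q (+ r)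
  ≡0mod⇒Valuation≥ {q} {r} (s , (k , z , bᵏs≡z) , q≡pʳs) with q ℚ.≟ 0ℚ
  ... | yes q≡0 = inj₁ q≡0
  ... | no  q≢0 = inj₂ (+ i , (i , 0 , (pⁱ∣↥q , ¬pⁱ⁺¹∣↥q) , (p⁰∣↧q , p∤↧q) , sym (ℤ.+-identityʳ (+ i))) , +≤+ r≤i)
    where
    open ≡-Reasoning
    bᵏ↥q≡zpʳ↧q : b ^ k * ↥ q ≡ z * + (p ℕ.^ r) * ↧ q
    bᵏ↥q≡zpʳ↧q = clear-fraction (b ^ k) (z * + (p ℕ.^ r)) q (begin
      (b ^ k / 1) ℚ.* q                            ≡⟨ cong ((b ^ k / 1) ℚ.*_) q≡pʳs ⟩
      (b ^ k / 1) ℚ.* ((+ (p ℕ.^ r) / 1) ℚ.* s)    ≡⟨ solve 3 (λ x y s → x :* (y :* s) := (x :* s) :* y) refl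
                                                        (b ^ k / 1) (+ (p ℕ.^ r) / 1) s ⟩
      (b ^ k / 1) ℚ.* s ℚ.* (+ (p ℕ.^ r) / 1)      ≡⟨ cong (ℚ._* (+ (p ℕ.^ r) / 1)) bᵏs≡z ⟩
      (z / 1) ℚ.* (+ (p ℕ.^ r) / 1)                ≡⟨ /1-homo-* z (+ (p ℕ.^ r)) ⟨
      (z * + (p ℕ.^ r)) / 1                        ∎)
      where open ℚ-Solver.+-*-Solver
    valuation = integerValuation pp (q≢0 ∘ ℚ.↥p≡0⇒p≡0 q)
    i        = proj₁ valuation
    pⁱ∣↥q    = proj₁ (proj₂ valuation)
    ¬pⁱ⁺¹∣↥q = proj₂ (proj₂ valuation)
    pʳ∣↥q : + (p ℕ.^ r) ∣ ↥ q
    pʳ∣↥q = coprime-^-cancel (coprime-^ b⊥p r) k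
      (subst (+ (p ℕ.^ r) ∣_) (sym bᵏ↥q≡zpʳ↧q) (∣m⇒∣m*n (↧ q) (divides z refl)))
    r≤i : r ≤ i
    r≤i = ℕ.≮⇒≥ (λ i<r →
      ¬pⁱ⁺¹∣↥q (^∣ᵤ⇒^∣ {k = suc i} (ℕ.∣-trans (^-monoʳ-∣ p i<r) (∣⇒∣ᵤ pʳ∣↥q))))
    p⁰∣↧q : (+ p) ^ 0 ∣ ↧ q
    p⁰∣↧q = divides (↧ q) (sym (ℤ.*-identityʳ (↧ q)))
    p∤↧q : ¬ (+ p) ^ 1 ∣ ↧ q
    p∤↧q p¹∣↧q = ℕ.>⇒≢ (prime⇒1< pp) (coprime-↥↧ q (∣⇒∣ᵤ p∣↥q , ∣⇒∣ᵤ p∣↧q))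
      where
      p∣↧q : + p ∣ ↧ q
      p∣↧q = subst (_∣ ↧ q) (ℤ.*-identityʳ (+ p)) p¹∣↧q
      p∣↥q : + p ∣ ↥ q
      p∣↥q = coprime-^-cancel b⊥p k (subst (+ p ∣_) (sym bᵏ↥q≡zpʳ↧q) (∣n⇒∣m*n (z * + (p ℕ.^ r)) p∣↧q))

  -- Write the denominator as `c * (+ p) ^ j` with `c` prime to `p`. The numerator `↥ q` is
  -- divisible by the power `r ℕ.+ j` of `p`; cancelling the power `j` leaves `c * z` divisible by
  -- the power `r`, and `c` drops out by coprimality.
  Valuation≥⇒∣ : ∀ {q r} (q∈ : q ∈ℤ[1/ b ]) → Valuation≥ p q (+ r) → + (p ℕ.^ r) ∣ numerator q∈
  Valuation≥⇒∣ (k , _ , bᵏq≡z) (inj₁ refl) =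
    divides 0ℤ (/1-injective (trans (sym bᵏq≡z) (ℚ.*-zeroʳ (b ^ k / 1))))
  Valuation≥⇒∣ {q} {r} (k , z , bᵏq≡z) (inj₂ (_ , (i , j , (pⁱ∣↥q , _) , (divides c ↧q≡cpʲ , pʲ⁺¹∤↧q) , refl) , r≤i-j)) =
    ∣ᵤ⇒∣ (coprime-divisor (Coprimality.sym (coprime-^ (Coprimality.sym (∤⇒coprime p∤c)) r))
      (subst (p ℕ.^ r ℕ.∣_) (ℤ.abs-* c z) (∣⇒∣ᵤ pʳ∣cz)))
    where
    instance
      p≢0 : ℤ.NonZero ((+ p) ^ j)
      p≢0 = ℤ.≢-nonZero (λ eq → ℕ.≢-nonZero⁻¹ p {{prime⇒nonZero pp}} (ℤ.+-injective (ℤ.i^n≡0⇒i≡0 (+ p) j eq)))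
    p∤c : ¬ p ℕ.∣ ∣ c ∣
    p∤c p∣c = pʲ⁺¹∤↧q (subst ((+ p) ^ suc j ∣_) (sym ↧q≡cpʲ) (*-monoˡ-∣ ((+ p) ^ j) {+ p} {c} (∣ᵤ⇒∣ p∣c)))
    r+j≤i : r ℕ.+ j ≤ i
    r+j≤i = ℤ.drop‿+≤+ (subst (+ (r ℕ.+ j) ℤ.≤_)
      (solve 2 (λ i j → (i :- j) :+ j := i) refl (+ i) (+ j)) (ℤ.+-monoˡ-≤ (+ j) r≤i-j))
      where open ℤ-Solver.+-*-Solver
    pʳ⁺ʲ∣↥q : (+ p) ^ (r ℕ.+ j) ∣ ↥ q
    pʳ⁺ʲ∣↥q = ^∣ᵤ⇒^∣ {k = r ℕ.+ j} (ℕ.∣-trans (^-monoʳ-∣ p r+j≤i) (^∣⇒^∣ᵤ {k = i} pⁱ∣↥q))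
    pʳpʲ∣czpʲ : (+ p) ^ r * (+ p) ^ j ∣ c * z * (+ p) ^ j
    pʳpʲ∣czpʲ = subst (_∣ c * z * (+ p) ^ j) (ℤ.^-distribˡ-+-* (+ p) r j)
      (subst ((+ p) ^ (r ℕ.+ j) ∣_) eq (∣n⇒∣m*n (b ^ k) pʳ⁺ʲ∣↥q))
      where
      open ℤ-Solver.+-*-Solver
      eq : b ^ k * ↥ q ≡ c * z * (+ p) ^ j
      eq = trans (clear-fraction (b ^ k) z q bᵏq≡z) (trans (cong (z *_) ↧q≡cpʲ)
        (solve 3 (λ z c x → z :* (c :* x) := c :* z :* x) refl z c ((+ p) ^ j)))
    pʳ∣cz : + (p ℕ.^ r) ∣ c * z
    pʳ∣cz = subst (_∣ c * z) (sym (pos-^ p r)) (*-cancelʳ-∣ ((+ p) ^ j) pʳpʲ∣czpʲ)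

-- Compactness of ℤₚ

^∣^+ : ∀ x k r → x ^ r ∣ x ^ (k ℕ.+ r)
^∣^+ x k r = divides (x ^ k) (ℤ.^-distribˡ-+-* x k r)

-- The difference telescopes into `k` coherence relations, each at precision at least `r`.
residue-coherent : ∀ {p} (x : ℤₚ p) k r → (+ p) ^ r ∣ residue x (k ℕ.+ r) - residue x r
residue-coherent x zero    r = divides 0ℤ (ℤ.+-inverseʳ (residue x r))
residue-coherent {p} x (suc k) r = subst ((+ p) ^ r ∣_)
  (solve 3 (λ a b c → (a :- b) :+ (b :- c) := a :- c) refl
    (residue x (suc k ℕ.+ r)) (residue x (k ℕ.+ r)) (residue x r))
  (∣m∣n⇒∣m+n (∣-trans (^∣^+ (+ p) k r) (coherent x (k ℕ.+ r))) (residue-coherent x k r))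
  where open ℤ-Solver.+-*-Solver

-- The congruence asks for an actual p-adic quotient of `n - x` by the power `r` of `p`. Division
-- costs `r` digits, so its `k`-th residue is computed from residue `k ℕ.+ r` of `x`.
≡residue⇒≡ᵖ : ∀ {p} .{{_ : NonZero p}} (x : ℤₚ p) n r →
              (+ p) ^ r ∣ n - residue x r → fromℤ n ≡ᵖ x mod-pow r
≡residue⇒≡ᵖ {p} x n r pʳ∣n-xᵣ = z , λ k →
  subst ((+ p) ^ k ∣_) (z-spec k)
    (subst (λ j → (+ p) ^ k ∣ residue x j - residue x k) (ℕ.+-comm r k) (residue-coherent x r k))
  where
  open ℤ-Solver.+-*-Solver
  instance
    pʳ≢0 : ℤ.NonZero ((+ p) ^ r)
    pʳ≢0 = ℤ.≢-nonZero (λ eq → ℕ.≢-nonZero⁻¹ p (ℤ.+-injective (ℤ.i^n≡0⇒i≡0 (+ p) r eq)))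
  pʳ∣ : ∀ k → (+ p) ^ r ∣ n - residue x (k ℕ.+ r)
  pʳ∣ k = subst ((+ p) ^ r ∣_)
    (solve 3 (λ n a b → (n :- a) :- (b :- a) := n :- b) refl n (residue x r) (residue x (k ℕ.+ r)))
    (∣m∣n⇒∣m-n pʳ∣n-xᵣ (residue-coherent x k r))
  z : ℤₚ p
  z .residue k  = _∣_.quotient (pʳ∣ k)
  z .coherent k = *-cancelʳ-∣ ((+ p) ^ r) (subst (_∣ (z₁ - z₀) * (+ p) ^ r) (ℤ.^-distribˡ-+-* (+ p) k r)
    (subst ((+ p) ^ (k ℕ.+ r) ∣_) eq (∣n⇒∣m*n (ℤ.- 1ℤ) (coherent x (k ℕ.+ r)))))
    where
    open ≡-Reasoning
    z₁ = _∣_.quotient (pʳ∣ (suc k))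
    z₀ = _∣_.quotient (pʳ∣ k)
    x₁ = residue x (suc k ℕ.+ r)
    x₀ = residue x (k ℕ.+ r)
    eq : (ℤ.- 1ℤ) * (x₁ - x₀) ≡ (z₁ - z₀) * (+ p) ^ r
    eq = begin
      (ℤ.- 1ℤ) * (x₁ - x₀)              ≡⟨ solve 3 (λ n a b → con (ℤ.- 1ℤ) :* (a :- b) := (n :- a) :- (n :- b)) refl
                                             n x₁ x₀ ⟩
      (n - x₁) - (n - x₀)               ≡⟨ cong₂ _-_ (_∣_.equality (pʳ∣ (suc k))) (_∣_.equality (pʳ∣ k)) ⟩
      z₁ * (+ p) ^ r - z₀ * (+ p) ^ r   ≡⟨ solve 3 (λ a b c → a :* c :- b :* c := (a :- b) :* c) refl z₁ z₀ ((+ p) ^ r) ⟩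
      (z₁ - z₀) * (+ p) ^ r             ∎
  z-spec : ∀ k → residue x (k ℕ.+ r) - residue x k ≡ (n - residue x k) - (+ p) ^ r * residue z k
  z-spec k = begin
    residue x (k ℕ.+ r) - residue x k
      ≡⟨ solve 3 (λ n a b → b :- a := (n :- a) :- (n :- b)) refl n (residue x k) (residue x (k ℕ.+ r)) ⟩
    (n - residue x k) - (n - residue x (k ℕ.+ r))
      ≡⟨ cong (n - residue x k -_) (trans (_∣_.equality (pʳ∣ k)) (ℤ.*-comm (residue z k) ((+ p) ^ r))) ⟩
    (n - residue x k) - (+ p) ^ r * residue z k ∎
    where open ≡-Reasoning

module Classical (em : ExcludedMiddle 0ℓ) where

  -- If alternative `zero` fails at some `s₀`, antitonicity makes it fail from there on. Asking the
  -- cover at `s ℕ.⊔ s₀` then always yields a later alternative, which holds at `s` by antitonicity.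
  antitone-pigeonhole : ∀ {n} (P : Fin n → ℕ → Set) → (∀ {j r s} → r ≤ s → P j s → P j r) →
                        (∀ s → ∃[ j ] P j s) → ∃[ j ] ∀ s → P j s
  antitone-pigeonhole {zero} P antitone cover with () ← proj₁ (cover 0)
  antitone-pigeonhole {suc n} P antitone cover with em {∃[ s ] ¬ P zero s}
  ... | no ¬∃           = zero , λ s → decidable-stable em (λ ¬P₀s → ¬∃ (s , ¬P₀s))
  ... | yes (s₀ , ¬P₀s₀) =
    let j , Pⱼ = antitone-pigeonhole (P ∘ suc) antitone cover′ in suc j , Pⱼ
    where
    cover′ : ∀ s → ∃[ j ] P (suc j) s
    cover′ s with cover (s ℕ.⊔ s₀)
    ... | zero  , P₀ = contradiction (antitone (ℕ.m≤n⊔m s s₀) P₀) ¬P₀s₀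
    ... | suc j , Pⱼ = j , antitone (ℕ.m≤m⊔n s s₀) Pⱼ

  module _ {p} .{{_ : NonZero p}} {w : ℤ → ℚ} where

    -- The residue class a mod pʳ contains n with v_p(w n) arbitrarily large.
    ClusterResidue : ℕ → ℤ → Set
    ClusterResidue r a = ∀ s → ∃[ n ] Valuation≥ p (w n) (+ s) × (+ p) ^ r ∣ n - a

    -- The step of König's lemma: the class of `a` splits into `p` classes at the next precision,
    -- and the pigeonhole principle finds one that still contains arbitrarily large valuations.
    refine : ∀ r a → ClusterResidue r a → ∃[ a′ ] ClusterResidue (suc r) a′ × (+ p) ^ r ∣ a′ - a
    refine r a cluster =
      let j , clusterⱼ = antitone-pigeonhole P (λ {j} → antitone {j}) cover
      in a + + toℕ j * (+ p) ^ r , clusterⱼ ,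
         divides (+ toℕ j) (solve 2 (λ a x → (a :+ x) :- a := x) refl a (+ toℕ j * (+ p) ^ r))
      where
      open ℤ-Solver.+-*-Solver
      P : Fin p → ℕ → Set
      P j s = ∃[ n ] Valuation≥ p (w n) (+ s) × (+ p) ^ suc r ∣ n - (a + + toℕ j * (+ p) ^ r)
      antitone : ∀ {j r s} → r ≤ s → P j s → P j r
      antitone r≤s (n , v , d) = n , Valuation≥-antitone r≤s v , d
      cover : ∀ s → ∃[ j ] P j s
      cover s with n , v , divides q n-a≡qpʳ ← cluster s =
        -- The next base-`p` digit of `n` relative to `a` is the remainder of `q` modulo `p`.
        fromℕ< (n%ℕd<d q p) , n , v , divides (q /ℕ p) (begin
          n - (a + + toℕ (fromℕ< (n%ℕd<d q p)) * (+ p) ^ r)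
            ≡⟨ cong (λ i → n - (a + + i * (+ p) ^ r)) (toℕ-fromℕ< (n%ℕd<d q p)) ⟩
          n - (a + + (q %ℕ p) * (+ p) ^ r)
            ≡⟨ solve 3 (λ n a x → n :- (a :+ x) := (n :- a) :- x) refl n a (+ (q %ℕ p) * (+ p) ^ r) ⟩
          (n - a) - + (q %ℕ p) * (+ p) ^ r
            ≡⟨ cong (_- + (q %ℕ p) * (+ p) ^ r) (trans n-a≡qpʳ (cong (_* (+ p) ^ r) (a≡a%ℕn+[a/ℕn]*n q p))) ⟩
          (+ (q %ℕ p) + q /ℕ p * + p) * (+ p) ^ r - + (q %ℕ p) * (+ p) ^ r
            ≡⟨ solve 4 (λ i d p x → (i :+ d :* p) :* x :- i :* x := d :* (p :* x)) refl
                 (+ (q %ℕ p)) (q /ℕ p) (+ p) ((+ p) ^ r) ⟩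
          q /ℕ p * (+ p) ^ suc r ∎)
        where open ≡-Reasoning

    unbounded⇒padicZero : (∀ r → ∃[ n ] Valuation≥ p (w n) (+ r)) → HasPadicZero p w
    -- The diagonal choice: the `r`-th integer comes from the class of precision `r` and has
    -- valuation at least `r`.
    unbounded⇒padicZero unbounded = x , (λ r → proj₁ (cluster r r)) ,
      λ r _ → proj₁ (proj₂ (cluster r r)) , ≡residue⇒≡ᵖ x (proj₁ (cluster r r)) r (proj₂ (proj₂ (cluster r r)))
      where
      approximation : ∀ r → ∃ (ClusterResidue r)
      approximation zero    = 0ℤ , λ s →
        let n , v = unbounded s in n , v , divides (n - 0ℤ) (sym (ℤ.*-identityʳ (n - 0ℤ)))
      approximation (suc r) =
        let a , cluster , _ = refine r (proj₁ (approximation r)) (proj₂ (approximation r)) in a , cluster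
      cluster : ∀ r → ClusterResidue r (proj₁ (approximation r))
      cluster r = proj₂ (approximation r)
      x : ℤₚ p
      x .residue r  = proj₁ (approximation r)
      x .coherent r = proj₂ (proj₂ (refine r (proj₁ (approximation r)) (cluster r)))

    ¬padicZero⇒bounded : ¬ HasPadicZero p w → ∃[ r ] ∀ n → ¬ Valuation≥ p (w n) (+ r)
    ¬padicZero⇒bounded ¬zero with em {∃[ r ] ∀ n → ¬ Valuation≥ p (w n) (+ r)}
    ... | yes bounded = bounded
    ... | no ¬bounded = contradiction (unbounded⇒padicZero unbounded) ¬zero
      where
      unbounded : ∀ r → ∃[ n ] Valuation≥ p (w n) (+ r)
      unbounded r with em {∃[ n ] Valuation≥ p (w n) (+ r)}
      ... | yes ∃n = ∃n
      ... | no ¬∃n = contradiction (r , λ n v → ¬∃n (n , v)) ¬bounded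

-- Recurrent bi-sequences modulo m

ℤ-induction : (P : ℤ → Set) → (∀ {n} → P n → P (1ℤ + n)) → (∀ {n} → P (1ℤ + n) → P n) →
              P 0ℤ → ∀ n → P n
ℤ-induction P up down P₀ (+ zero)       = P₀
ℤ-induction P up down P₀ (+ suc n)      = up (ℤ-induction P up down P₀ (+ n))
ℤ-induction P up down P₀ -[1+ zero ]    = down P₀
ℤ-induction P up down P₀ -[1+ suc n ]   = down (ℤ-induction P up down P₀ -[1+ n ])

-- The product of all values works. The predicate `Q` carries multiplicative side conditions along:
-- being nonzero for denominators, and also being prime to `b` for moduli.
commonMultiple : (Q : ℕ → Set) → Q 1 → (∀ {x y} → Q x → Q y → Q (x ℕ.* y)) →
                 ∀ {n} (f : Fin n → ℕ) → (∀ i → Q (f i)) → ∃[ m ] Q m × (∀ i → f i ℕ.∣ m)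
commonMultiple Q Q1 Q* {zero}  f Qf = 1 , Q1 , λ ()
commonMultiple Q Q1 Q* {suc n} f Qf with m , Qm , f∣m ← commonMultiple Q Q1 Q* (f ∘ suc) (Qf ∘ suc) =
  f zero ℕ.* m , Q* (Qf zero) Qm , λ where
    zero    → ℕ.m∣m*n m
    (suc i) → ℕ.∣-trans (f∣m i) (ℕ.n∣m*n (f zero))

-- Inverses and residue classes modulo m

∣b∣-multiple : ∀ b → ∃[ s ] s * b ≡ + ∣ b ∣
∣b∣-multiple (+ n)      = 1ℤ , ℤ.*-identityˡ (+ n)
∣b∣-multiple -[1+ n ]   = ℤ.- 1ℤ , ℤ.-1*i≡-i -[1+ n ]

-- Bézout over the naturals comes in two forms, according to which side carries the 1; the second
-- one negates the inverse. The sign `s` of `b` passes from `∣ b ∣` to `b`.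
coprime⇒inverse : ∀ b {m} → Coprime ∣ b ∣ m → ∃[ c ] + m ∣ b * c - 1ℤ
coprime⇒inverse b {m} b⊥m with s , sb≡∣b∣ ← ∣b∣-multiple b | coprime-Bézout b⊥m
... | ℕ.Bézout.+- x y eq = s * + x , divides (+ y) (begin
  b * (s * + x) - 1ℤ         ≡⟨ solve 3 (λ b s x → b :* (s :* x) :- con 1ℤ := x :* (s :* b) :- con 1ℤ) refl b s (+ x) ⟩
  + x * (s * b) - 1ℤ         ≡⟨ cong (λ i → + x * i - 1ℤ) sb≡∣b∣ ⟩
  + x * + ∣ b ∣ - 1ℤ         ≡⟨ cong (_- 1ℤ) (trans (sym (ℤ.pos-* x ∣ b ∣))
                                  (trans (cong +_ (sym eq)) (cong (λ i → 1ℤ + i) (ℤ.pos-* y m)))) ⟩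
  (1ℤ + + y * + m) - 1ℤ      ≡⟨ solve 1 (λ i → (con 1ℤ :+ i) :- con 1ℤ := i) refl (+ y * + m) ⟩
  + y * + m                  ∎)
  where
  open ≡-Reasoning
  open ℤ-Solver.+-*-Solver
... | ℕ.Bézout.-+ x y eq = ℤ.- (s * + x) , divides (ℤ.- + y) (begin
  b * ℤ.- (s * + x) - 1ℤ     ≡⟨ solve 3 (λ b s x → b :* (:- (s :* x)) :- con 1ℤ := :- (con 1ℤ :+ x :* (s :* b)))
                                  refl b s (+ x) ⟩
  ℤ.- (1ℤ + + x * (s * b))   ≡⟨ cong (λ i → ℤ.- (1ℤ + + x * i)) sb≡∣b∣ ⟩
  ℤ.- (1ℤ + + x * + ∣ b ∣)   ≡⟨ cong ℤ.-_ (trans (cong (λ i → 1ℤ + i) (sym (ℤ.pos-* x ∣ b ∣)))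
                                  (trans (cong +_ eq) (ℤ.pos-* y m))) ⟩
  ℤ.- (+ y * + m)            ≡⟨ ℤ.neg-distribˡ-* (+ y) (+ m) ⟩
  ℤ.- + y * + m              ∎)
  where
  open ≡-Reasoning
  open ℤ-Solver.+-*-Solver

∣x-1⇒∣xᵏ-1 : ∀ {m x} → m ∣ x - 1ℤ → ∀ k → m ∣ x ^ k - 1ℤ
∣x-1⇒∣xᵏ-1         m∣x-1 zero    = divides 0ℤ refl
∣x-1⇒∣xᵏ-1 {m} {x} m∣x-1 (suc k) = subst (m ∣_)
  (solve 2 (λ x y → x :* (y :- con 1ℤ) :+ (x :- con 1ℤ) := x :* y :- con 1ℤ) refl x (x ^ k))
  (∣m∣n⇒∣m+n (∣n⇒∣m*n x (∣x-1⇒∣xᵏ-1 m∣x-1 k)) m∣x-1)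
  where open ℤ-Solver.+-*-Solver

module ModuloClass (b : ℤ) (m : ℕ) .{{_ : NonZero m}} (b⊥m : Coprime ∣ b ∣ m) where
  open Localization b

  b⁻¹ : ℤ
  b⁻¹ = proj₁ (coprime⇒inverse b b⊥m)

  -- The class of z / bᵏ in ℤ[1/b]/(m) = ℤ/m.
  class : ∀ {q} → q ∈ℤ[1/ b ] → Fin m
  class (k , z , _) = fromℕ< (n%ℕd<d (z * b⁻¹ ^ k) m)

  class≡⇒≡0mod : ∀ {x y} (x∈ : x ∈ℤ[1/ b ]) (y∈ : y ∈ℤ[1/ b ]) → class x∈ ≡ class y∈ →
                 (x ℚ.- y) ≡0mod m inℤ[1/ b ]
  class≡⇒≡0mod {x} {y} x∈@(k , z , _) y∈@(j , w , _) same =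
    -- The difference is built as `x + (-1) * y`, so that the closure lemmas give it the explicit
    -- numerator in `m∣difference`.
    subst (_≡0mod m inℤ[1/ b ])
      (x+[-1]y≡x-y x y)
      (∣⇒≡0mod (+-∈ x∈ (*-∈ (integer∈ (ℤ.- 1ℤ)) y∈)) m∣difference)
    where
    x+[-1]y≡x-y : ∀ x y → x ℚ.+ (ℚ.- 1ℚ) ℚ.* y ≡ x ℚ.- y
    x+[-1]y≡x-y = solve 2 (λ x y → x :+ con (ℚ.- 1ℚ) :* y := x :- y) refl
      where open ℚ-Solver.+-*-Solver
    same% : (z * b⁻¹ ^ k) %ℕ m ≡ (w * b⁻¹ ^ j) %ℕ m
    same% = trans (sym (toℕ-fromℕ< (n%ℕd<d (z * b⁻¹ ^ k) m)))
      (trans (cong toℕ same) (toℕ-fromℕ< (n%ℕd<d (w * b⁻¹ ^ j) m)))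
    m∣z-w : + m ∣ z * b⁻¹ ^ k - w * b⁻¹ ^ j
    m∣z-w = divides ((z * b⁻¹ ^ k) /ℕ m - (w * b⁻¹ ^ j) /ℕ m) (begin
      z * b⁻¹ ^ k - w * b⁻¹ ^ j
        ≡⟨ cong₂ _-_ (a≡a%ℕn+[a/ℕn]*n (z * b⁻¹ ^ k) m) (a≡a%ℕn+[a/ℕn]*n (w * b⁻¹ ^ j) m) ⟩
      (+ ((z * b⁻¹ ^ k) %ℕ m) + (z * b⁻¹ ^ k) /ℕ m * + m) - (+ ((w * b⁻¹ ^ j) %ℕ m) + (w * b⁻¹ ^ j) /ℕ m * + m)
        ≡⟨ cong (λ r → (+ r + (z * b⁻¹ ^ k) /ℕ m * + m) - (+ ((w * b⁻¹ ^ j) %ℕ m) + (w * b⁻¹ ^ j) /ℕ m * + m)) same% ⟩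
      (+ ((w * b⁻¹ ^ j) %ℕ m) + (z * b⁻¹ ^ k) /ℕ m * + m) - (+ ((w * b⁻¹ ^ j) %ℕ m) + (w * b⁻¹ ^ j) /ℕ m * + m)
        ≡⟨ solve 4 (λ r s t m → (r :+ s :* m) :- (r :+ t :* m) := (s :- t) :* m) refl
             (+ ((w * b⁻¹ ^ j) %ℕ m)) ((z * b⁻¹ ^ k) /ℕ m) ((w * b⁻¹ ^ j) /ℕ m) (+ m) ⟩
      ((z * b⁻¹ ^ k) /ℕ m - (w * b⁻¹ ^ j) /ℕ m) * + m ∎)
      where
      open ≡-Reasoning
      open ℤ-Solver.+-*-Solver
    m∣bᵏcᵏ-1 : ∀ k → + m ∣ b ^ k * b⁻¹ ^ k - 1ℤ
    m∣bᵏcᵏ-1 k = subst (λ i → + m ∣ i - 1ℤ) (^-distrib-* b b⁻¹ k) (∣x-1⇒∣xᵏ-1 (proj₂ (coprime⇒inverse b b⊥m)) k)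
    m∣difference : + m ∣ b ^ j * z + b ^ k * (ℤ.- 1ℤ * w)
    -- The congruence `m∣z-w` is multiplied by `b ^ k * b ^ j`; the two other terms replace the
    -- products of powers of `b` and `b⁻¹` by 1.
    m∣difference = subst (+ m ∣_)
      (solve 6 (λ B C z w c d →
                  (B :* C :* (z :* c :- w :* d) :- z :* C :* (B :* c :- con 1ℤ)) :+ w :* B :* (C :* d :- con 1ℤ)
                  := C :* z :+ B :* (con (ℤ.- 1ℤ) :* w))
        refl (b ^ k) (b ^ j) z w (b⁻¹ ^ k) (b⁻¹ ^ j))
      (∣m∣n⇒∣m+n (∣m∣n⇒∣m-n (∣n⇒∣m*n (b ^ k * b ^ j) m∣z-w)
                             (∣n⇒∣m*n (z * b ^ j) (m∣bᵏcᵏ-1 k)))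
                 (∣n⇒∣m*n (w * b ^ k) (m∣bᵏcᵏ-1 j)))
      where open ℤ-Solver.+-*-Solver

-- Reversible recurrences and their periods

module _ (R : Recurrence) where
  private instance
    a₀-nonZero : ℚ.NonZero (coeffs R zero)
    a₀-nonZero = ℚ.≢-nonZero (a₀≢0 R)

  a₀⁻¹ : ℚ
  a₀⁻¹ = ℚ.1/ coeffs R zero

  -- Integral coefficients carry congruences forwards along the recurrence; an integral inverse of
  -- the last one, `coeffs R zero`, carries them backwards.
  ReversibleOver : ℤ → Set
  ReversibleOver b = (∀ i → coeffs R i ∈ℤ[1/ b ]) × a₀⁻¹ ∈ℤ[1/ b ]

  -- Multiply `b` by a common multiple `D` of the denominators of the coefficients and of `a₀⁻¹`;
  -- keeping the factor `b` preserves membership of the sequence values.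
  ∃-reversibleOver : ∀ {b} → b ≢ 0ℤ → ∃[ c ] c ≢ 0ℤ × b ∣ c × ReversibleOver c
  ∃-reversibleOver {b} b≢0
    with D , D≢0 , ↧∣D ← commonMultiple NonZero _ (λ {x} {y} x≢0 y≢0 → ℕ.m*n≢0 x y {{x≢0}} {{y≢0}})
                           (λ i → ℚ.↧ₙ (a₀⁻¹ Vector.∷ coeffs R) i) (λ _ → _) =
    b * + D ,
    (λ bD≡0 → [ b≢0 , ℕ.≢-nonZero⁻¹ D {{D≢0}} ∘ ℤ.+-injective ]′ (ℤ.i*j≡0⇒i≡0∨j≡0 b bD≡0)) ,
    ∣m⇒∣m*n (+ D) ∣-refl ,
    (λ i → member (suc i)) , member zero
    where
    member : ∀ i → (a₀⁻¹ Vector.∷ coeffs R) i ∈ℤ[1/ b * + D ]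
    member i = ∈-∣ (∣n⇒∣m*n b (∣ᵤ⇒∣ (↧∣D i))) (∈-denominator ((a₀⁻¹ Vector.∷ coeffs R) i))

  module Periodicity {b : ℤ} {m : ℕ} {u : ℤ → ℚ} (reversible : ReversibleOver b) (holds : Holds R u) where
    open Localization b
    open Ideal m

    private
      d = order R
      infix 4 _∼_
      _∼_ : ℤ → ℤ → Set
      i ∼ j = (u i ℚ.- u j) ≡0mod m inℤ[1/ b ]

    SameWindow : ℤ → ℤ → Set
    SameWindow i j = ∀ t → t < d → i + + t ∼ j + + t

    private
      term : ∀ c x y → c ∈ℤ[1/ b ] → (x ℚ.- y) ≡0mod m inℤ[1/ b ] →
             (c ℚ.* x ℚ.- c ℚ.* y) ≡0mod m inℤ[1/ b ]
      term c x y c∈ x≡y = subst (_≡0mod m inℤ[1/ b ])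
        (solve 3 (λ c x y → c :* (x :- y) := c :* x :- c :* y) refl c x y) (*-≡0mod c∈ x≡y)
        where open ℚ-Solver.+-*-Solver

      shift : ∀ i t → (1ℤ + i) + + t ≡ i + + suc t
      shift i t = solve 2 (λ i t → (con 1ℤ :+ i) :+ t := i :+ (con 1ℤ :+ t)) refl i (+ t)
        where open ℤ-Solver.+-*-Solver

    sameWindow-up : ∀ i j → SameWindow i j → SameWindow (1ℤ + i) (1ℤ + j)
    sameWindow-up i j same t (s≤s t≤d-1) = subst₂ _∼_ (sym (shift i t)) (sym (shift j t)) next
      where
      next : i + + suc t ∼ j + + suc t
      next with ℕ.m≤n⇒m<n∨m≡n t≤d-1
      ... | inj₁ t<d-1 = same (suc t) (s≤s t<d-1)
      -- Only the last entry of the moved window is new; the recurrence expresses it through the old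
      -- window.
      ... | inj₂ refl  = subst₂ (λ x y → (x ℚ.- y) ≡0mod m inℤ[1/ b ]) (sym (holds i)) (sym (holds j))
        (sum-≡0mod (λ t → coeffs R t ℚ.* u (i + + toℕ t)) (λ t → coeffs R t ℚ.* u (j + + toℕ t)) (λ t →
          term _ (u (i + + toℕ t)) (u (j + + toℕ t)) (proj₁ reversible t) (same (toℕ t) (toℕ<n t))))

    -- Only the first entry is new. Solving the recurrence for it, one subtracts the other terms
    -- from the top value and multiplies by `a₀⁻¹`.
    sameWindow-down : ∀ i j → SameWindow (1ℤ + i) (1ℤ + j) → SameWindow i j
    sameWindow-down i j same (suc t) t+1<d =
      subst₂ _∼_ (shift i t) (shift j t) (same t (ℕ.<-trans ℕ.≤-refl t+1<d))
    sameWindow-down i j same zero    _     = subst (_≡0mod m inℤ[1/ b ]) solved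
      (*-≡0mod (proj₂ reversible) (+-≡0mod top (neg-≡0mod tails)))
      where
      open ℚ-Solver.+-*-Solver
      tailTerm : ℤ → Fin (pred-order R) → ℚ
      tailTerm i t = coeffs R (suc t) ℚ.* u (i + + suc (toℕ t))
      tail : ℤ → ℚ
      tail i = sum (tailTerm i)
      top : i + + d ∼ j + + d
      top = subst₂ _∼_ (shift i (pred-order R)) (shift j (pred-order R)) (same (pred-order R) ℕ.≤-refl)
      tails : (tail i ℚ.- tail j) ≡0mod m inℤ[1/ b ]
      tails = sum-≡0mod (tailTerm i) (tailTerm j) (λ t →
        term _ (u (i + + suc (toℕ t))) (u (j + + suc (toℕ t))) (proj₁ reversible (suc t))
        (subst₂ _∼_ (shift i (toℕ t)) (shift j (toℕ t)) (same (toℕ t) (ℕ.<-trans (toℕ<n t) ℕ.≤-refl))))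
      a₀ = coeffs R zero
      x  = u (i + 0ℤ)
      y  = u (j + 0ℤ)
      solved : a₀⁻¹ ℚ.* ((u (i + + d) ℚ.- u (j + + d)) ℚ.+ (ℚ.- (tail i ℚ.- tail j))) ≡ x ℚ.- y
      solved = begin
        a₀⁻¹ ℚ.* ((u (i + + d) ℚ.- u (j + + d)) ℚ.+ (ℚ.- (tail i ℚ.- tail j)))
          ≡⟨ cong₂ (λ s t → a₀⁻¹ ℚ.* ((s ℚ.- t) ℚ.+ (ℚ.- (tail i ℚ.- tail j)))) (holds i) (holds j) ⟩
        a₀⁻¹ ℚ.* (((a₀ ℚ.* x ℚ.+ tail i) ℚ.- (a₀ ℚ.* y ℚ.+ tail j)) ℚ.+ (ℚ.- (tail i ℚ.- tail j)))
          ≡⟨ solve 6 (λ c a x y s t → c :* (((a :* x :+ s) :- (a :* y :+ t)) :+ (:- (s :- t)))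
                                      := (c :* a) :* (x :- y)) refl
               a₀⁻¹ a₀ x y (tail i) (tail j) ⟩
        (a₀⁻¹ ℚ.* a₀) ℚ.* (x ℚ.- y)
          ≡⟨ cong (ℚ._* (x ℚ.- y)) (ℚ.*-inverseˡ a₀) ⟩
        1ℚ ℚ.* (x ℚ.- y)
          ≡⟨ ℚ.*-identityˡ (x ℚ.- y) ⟩
        x ℚ.- y ∎
        where open ≡-Reasoning

    sameWindow⇒periodic : ∀ i j → SameWindow i j → ∀ n → n + i ∼ n + j
    sameWindow⇒periodic i j same n =
      subst₂ _∼_ (ℤ.+-identityʳ (n + i)) (ℤ.+-identityʳ (n + j)) (shifted n 0 (s≤s z≤n))
      where
      shifted : ∀ n → SameWindow (n + i) (n + j)
      shifted = ℤ-induction (λ n → SameWindow (n + i) (n + j))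
        (λ {n} same → subst₂ SameWindow (sym (ℤ.+-assoc 1ℤ n i)) (sym (ℤ.+-assoc 1ℤ n j)) (sameWindow-up (n + i) (n + j) same))
        (λ {n} same → sameWindow-down (n + i) (n + j) (subst₂ SameWindow (ℤ.+-assoc 1ℤ n i) (ℤ.+-assoc 1ℤ n j) same))
        (subst₂ SameWindow (sym (ℤ.+-identityˡ i)) (sym (ℤ.+-identityˡ j)) same)

    module _ .{{_ : NonZero m}} (b⊥m : Coprime ∣ b ∣ m) (u∈ : ∀ n → u n ∈ℤ[1/ b ]) where
      open ModuloClass b m b⊥m

      -- There are `m ℕ.^ d` possible windows of classes, encoded by `funToFin`, and one more
      -- starting point is tried. The later index comes first, so that the period is a positive
      -- difference.
      repeatedWindow : ∃[ i ] ∃[ j ] i < j × SameWindow (+ j) (+ i)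
      repeatedWindow =
        let i , j , i<j , same = pigeonhole ℕ.≤-refl state in
        toℕ i , toℕ j , i<j , λ t t<d →
          subst (λ t → + toℕ j + + t ∼ + toℕ i + + t) (toℕ-fromℕ< t<d)
            (class≡⇒≡0mod (u∈ (+ toℕ j + + toℕ (fromℕ< t<d))) (u∈ (+ toℕ i + + toℕ (fromℕ< t<d))) (begin
              window (toℕ j) (fromℕ< t<d)                 ≡⟨ finToFun-funToFin (window (toℕ j)) (fromℕ< t<d) ⟨
              finToFun (state j) (fromℕ< t<d)             ≡⟨ cong (λ s → finToFun s (fromℕ< t<d)) same ⟨
              finToFun (state i) (fromℕ< t<d)             ≡⟨ finToFun-funToFin (window (toℕ i)) (fromℕ< t<d) ⟩
              window (toℕ i) (fromℕ< t<d)                 ∎))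
        where
        open ≡-Reasoning
        window : ℕ → Fin d → Fin m
        window n t = class (u∈ (+ n + + toℕ t))
        state : Fin (suc (m ℕ.^ d)) → Fin (m ℕ.^ d)
        state n = funToFin (window (toℕ n))

      -- Moving the two equal windows by `n - + i` compares the values at `n` and `+ N + n`. As
      -- windows propagate in both directions, the period holds on all of ℤ.
      ∃-period : ∃[ N ] 1 ≤ N × (∀ n → + N + n ∼ n)
      ∃-period =
        let i , j , i<j , same = repeatedWindow in
        j ℕ.∸ i , ℕ.m<n⇒0<n∸m i<j , λ n → subst₂ _∼_
          (shifted n (+ i) (+ j) (+ (j ℕ.∸ i)) (cong +_ (ℕ.m∸n+n≡m (ℕ.<⇒≤ i<j))))
          (solve 2 (λ n i → (n :- i) :+ i := n) refl n (+ i))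
          (sameWindow⇒periodic (+ j) (+ i) same (n - + i))
        where
        open ℤ-Solver.+-*-Solver
        shifted : ∀ n i j N → N + i ≡ j → (n - i) + j ≡ N + n
        shifted n i _ N refl = solve 3 (λ n i N → (n :- i) :+ (N :+ i) := N :+ n) refl n i N

    period-* : ∀ N → (∀ n → N + n ∼ n) → ∀ ℓ q → N * q + ℓ ∼ ℓ
    period-* N period ℓ = ℤ-induction (λ q → N * q + ℓ ∼ ℓ) (λ {q} → up q) (λ {q} → down q)
      (subst (_∼ ℓ) (sym (trans (cong (_+ ℓ) (ℤ.*-zeroʳ N)) (ℤ.+-identityˡ ℓ)))
        (subst (_≡0mod m inℤ[1/ b ]) (sym (ℚ.+-inverseʳ (u ℓ))) 0≡0mod))
      where
      step : ∀ q → N * (1ℤ + q) + ℓ ∼ N * q + ℓ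
      step q = subst (_∼ N * q + ℓ)
        (solve 3 (λ N q ℓ → N :+ (N :* q :+ ℓ) := N :* (con 1ℤ :+ q) :+ ℓ) refl N q ℓ) (period (N * q + ℓ))
        where open ℤ-Solver.+-*-Solver
      up : ∀ q → N * q + ℓ ∼ ℓ → N * (1ℤ + q) + ℓ ∼ ℓ
      up q h = subst (_≡0mod m inℤ[1/ b ])
        (solve 3 (λ x y z → (x :- y) :+ (y :- z) := x :- z) refl (u (N * (1ℤ + q) + ℓ)) (u (N * q + ℓ)) (u ℓ))
        (+-≡0mod (step q) h)
        where open ℚ-Solver.+-*-Solver
      down : ∀ q → N * (1ℤ + q) + ℓ ∼ ℓ → N * q + ℓ ∼ ℓ
      down q h = subst (_≡0mod m inℤ[1/ b ])
        (solve 3 (λ x y z → (x :- z) :+ (:- (x :- y)) := y :- z) refl (u (N * (1ℤ + q) + ℓ)) (u (N * q + ℓ)) (u ℓ))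
        (+-≡0mod h (neg-≡0mod (step q)))
        where open ℚ-Solver.+-*-Solver

-- The two local conditions

ModularCondition : ℤ → (ℤ → ℚ) → Set
ModularCondition b u =
  ∃[ m ] 2 ≤ m × gcd b (+ m) ≡ 1ℤ × (∀ n → ¬ (u n ≡0mod m inℤ[1/ b ]))

PadicCondition : ℤ → (ℤ → ℚ) → Set
PadicCondition b u =
  ∃[ N ] 1 ≤ N ×
  (∃[ t ] Σ[ p ∈ (Fin t → ℕ) ]
    (∀ i → Prime (p i) × gcd b (+ (p i)) ≡ 1ℤ) ×
    (∀ (ℓ : Fin N) → ∃[ i ] ¬ HasPadicZero (p i) (λ n → u (+ N * n + + toℕ ℓ))))

gcd≡1⇒coprimeℤ : ∀ b {m} → gcd b (+ m) ≡ 1ℤ → Coprime ∣ b ∣ m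
gcd≡1⇒coprimeℤ b = gcd≡1⇒coprime ∘ ℤ.+-injective

coprimeℤ⇒gcd≡1 : ∀ b {m} → Coprime ∣ b ∣ m → gcd b (+ m) ≡ 1ℤ
coprimeℤ⇒gcd≡1 b = cong +_ ∘ coprime⇒gcd≡1

euclidean : ∀ N .{{_ : NonZero N}} n → + N * (n /ℕ N) + + toℕ (fromℕ< (n%ℕd<d n N)) ≡ n
euclidean N n = begin
  + N * (n /ℕ N) + + toℕ (fromℕ< (n%ℕd<d n N))   ≡⟨ cong (λ r → + N * (n /ℕ N) + + r) (toℕ-fromℕ< (n%ℕd<d n N)) ⟩
  + N * (n /ℕ N) + + (n %ℕ N)                    ≡⟨ solve 3 (λ N q r → N :* q :+ r := r :+ q :* N) refl (+ N) (n /ℕ N) (+ (n %ℕ N)) ⟩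
  + (n %ℕ N) + n /ℕ N * + N                      ≡⟨ a≡a%ℕn+[a/ℕn]*n n N ⟨
  n                                              ∎
  where
  open ≡-Reasoning
  open ℤ-Solver.+-*-Solver

-- The constant sequence `n` approximates the zero, since the value 0 has infinite valuation.
integerZero⇒padicZero : ∀ {p} w n → w n ≡ 0ℚ → HasPadicZero p w
integerZero⇒padicZero {p} w n wₙ≡0 = fromℤ n , (λ _ → n) , λ r _ → inj₁ wₙ≡0 , fromℤ 0ℤ , λ k →
  divides 0ℤ (solve 2 (λ n x → (n :- n) :- x :* con 0ℤ := con 0ℤ) refl n ((+ p) ^ r))
  where open ℤ-Solver.+-*-Solver

modular⇒¬integerZero : ∀ {b u} → ModularCondition b u → ¬ HasIntegerZero u
modular⇒¬integerZero {b} (m , _ , _ , ¬≡0) (n , uₙ≡0) =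
  ¬≡0 n (subst (_≡0mod m inℤ[1/ b ]) (sym uₙ≡0) (Localization.Ideal.0≡0mod b m))

-- An integer zero `n` of `u` is an integer zero, hence a p-adic one for every `p`, of the
-- subsequence given by the remainder of `n` modulo `N`.
padic⇒¬integerZero : ∀ b {u} → PadicCondition b u → ¬ HasIntegerZero u
padic⇒¬integerZero _ {u} (N@(suc _) , _ , t , p , _ , ¬zero) (n , uₙ≡0) =
  let i , ¬zeroᵢ = ¬zero (fromℕ< (n%ℕd<d n N)) in
  ¬zeroᵢ (integerZero⇒padicZero (λ q → u (+ N * q + + toℕ (fromℕ< (n%ℕd<d n N)))) (n /ℕ N) (trans (cong u (euclidean N n)) uₙ≡0))

modular⇒padic : ∀ {b c u} R → Holds R u → ReversibleOver R c → b ∣ c → (∀ n → u n ∈ℤ[1/ c ]) →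
                ModularCondition c u → PadicCondition b u
modular⇒padic {b} {c} {u} R holds reversible b∣c u∈ (m@(suc _) , _ , gcd≡1 , ¬≡0) =
  let N , 1≤N , period = ∃-period c⊥m u∈
      separate = separatingPrime N period
  -- One prime is listed per residue class, so the list has length `N` and `ℓ` is its own index.
  in N , 1≤N , N , (λ ℓ → proj₁ (separate ℓ)) , (λ ℓ → proj₁ (proj₂ (separate ℓ))) ,
     λ ℓ → ℓ , proj₂ (proj₂ (separate ℓ))
  where
  open Localization c
  open Periodicity R {c} {m} {u} reversible holds
  c⊥m : Coprime ∣ c ∣ m
  c⊥m = gcd≡1⇒coprimeℤ c gcd≡1
  separatingPrime : ∀ N → (∀ n → (u (+ N + n) ℚ.- u n) ≡0mod m inℤ[1/ c ]) → (ℓ : Fin N) →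
    ∃[ p ] (Prime p × gcd b (+ p) ≡ 1ℤ) × ¬ HasPadicZero p (λ n → u (+ N * n + + toℕ ℓ))
  separatingPrime N period ℓ
    with ∤⇒∃-primePower {m} (λ m∣uₗ → ¬≡0 (+ toℕ ℓ) (∣⇒≡0mod (u∈ (+ toℕ ℓ)) (∣ᵤ⇒∣ m∣uₗ)))
  ... | p , a , pp , pᵃ⁺¹∣m , pᵃ⁺¹∤uₗ =
    p , (pp , coprimeℤ⇒gcd≡1 b (coprime-∣ˡ (∣⇒∣ᵤ b∣c) c⊥p)) , λ (_ , n , zeros) →
      -- A p-adic zero is used at the single precision `suc a`: it gives a term of the subsequence
      -- divisible by that power of `p`, and periodicity modulo `m` transfers the divisibility to
      -- `u (+ toℕ ℓ)`.
      pᵃ⁺¹∤uₗ (∣⇒∣ᵤ (≡0mod⇒∣ (coprime-^ c⊥p (suc a)) (u∈ (+ toℕ ℓ))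
        (uₗ≡0 (n (suc a)) (proj₁ (zeros (suc a) (s≤s z≤n))))))
    where
    open Ideal (p ℕ.^ suc a)
    open ℚ-Solver.+-*-Solver
    instance
      pᵃ⁺¹≢0 : NonZero (p ℕ.^ suc a)
      pᵃ⁺¹≢0 = ℕ.m^n≢0 p (suc a) {{prime⇒nonZero pp}}
    c⊥p : Coprime ∣ c ∣ p
    c⊥p = coprime-∣ʳ (ℕ.∣-trans (ℕ.m∣m*n (p ℕ.^ a)) pᵃ⁺¹∣m) c⊥m
    uₗ≡0 : ∀ n → Valuation≥ p (u (+ N * n + + toℕ ℓ)) (+ suc a) →
           u (+ toℕ ℓ) ≡0mod (p ℕ.^ suc a) inℤ[1/ c ]
    uₗ≡0 n v = subst (_≡0mod (p ℕ.^ suc a) inℤ[1/ c ])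
      (solve 2 (λ x y → x :+ (:- (x :- y)) := y) refl (u k) (u (+ toℕ ℓ)))
      (+-≡0mod (∣⇒≡0mod (u∈ k) (Valuation≥⇒∣ pp c⊥p {r = suc a} (u∈ k) v))
               (neg-≡0mod (≡0mod-∣ pᵃ⁺¹∣m (period-* (+ N) period (+ toℕ ℓ) n))))
      where
      k = + N * n + + toℕ ℓ

padic⇒modular : ExcludedMiddle 0ℓ → ∀ {b u} → PadicCondition b u → ModularCondition b u
padic⇒modular em {b} {u} (N@(suc _) , _ , t , p , primes , ¬zero) =
  m , 2≤m , coprimeℤ⇒gcd≡1 b (proj₁ (proj₁ (proj₂ common))) , ¬≡0
  where
  open Classical em
  i : Fin N → Fin t
  i ℓ = proj₁ (¬zero ℓ)
  pp : ∀ ℓ → Prime (p (i ℓ))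
  pp ℓ = proj₁ (primes (i ℓ))
  b⊥p : ∀ ℓ → Coprime ∣ b ∣ (p (i ℓ))
  b⊥p ℓ = gcd≡1⇒coprimeℤ b (proj₂ (primes (i ℓ)))
  bounded : ∀ ℓ → ∃[ r ] ∀ n → ¬ Valuation≥ (p (i ℓ)) (u (+ N * n + + toℕ ℓ)) (+ r)
  bounded ℓ = ¬padicZero⇒bounded {{prime⇒nonZero (pp ℓ)}} (proj₂ (¬zero ℓ))
  power : Fin N → ℕ
  -- The exponent exceeds the bound by one, so that the prime itself divides `m` even if the bound
  -- is 0; this gives `2≤m`.
  power ℓ = p (i ℓ) ℕ.^ suc (proj₁ (bounded ℓ))
  common : ∃[ m ] (Coprime ∣ b ∣ m × NonZero m) × (∀ ℓ → power ℓ ℕ.∣ m)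
  common = commonMultiple (λ m → Coprime ∣ b ∣ m × NonZero m)
    (ℕ.∣1⇒≡1 ∘ proj₂ , _)
    (λ {x} {y} (b⊥x , x≢0) (b⊥y , y≢0) → coprime-* b⊥x b⊥y , ℕ.m*n≢0 x y {{x≢0}} {{y≢0}})
    power
    (λ ℓ → coprime-^ (b⊥p ℓ) (suc (proj₁ (bounded ℓ))) ,
           ℕ.m^n≢0 (p (i ℓ)) (suc (proj₁ (bounded ℓ))) {{prime⇒nonZero (pp ℓ)}})
  m = proj₁ common
  2≤m : 2 ≤ m
  2≤m = ℕ.≤-trans (prime⇒1< (pp zero)) (ℕ.∣⇒≤ {{proj₂ (proj₁ (proj₂ common))}}
    (ℕ.∣-trans (ℕ.m∣m*n (p (i zero) ℕ.^ proj₁ (bounded zero))) (proj₂ (proj₂ common) zero)))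
  ¬≡0 : ∀ n → ¬ (u n ≡0mod m inℤ[1/ b ])
  ¬≡0 n uₙ≡0 = proj₂ (bounded ℓ) (n /ℕ N)
    (Valuation≥-antitone (ℕ.n≤1+n r)
      (≡0mod⇒Valuation≥ {b} (pp ℓ) (b⊥p ℓ) {r = suc r}
        (Localization.≡0mod-∣ b (proj₂ (proj₂ common) ℓ)
          (subst (λ k → u k ≡0mod m inℤ[1/ b ]) (sym (euclidean N n)) uₙ≡0))))
    where
    ℓ = fromℕ< (n%ℕd<d n N)
    r = proj₁ (bounded ℓ)

mainTheorem6 : ExcludedMiddle 0ℓ →
    SkolemConjecture
    ⇔
    (∀ (b : ℤ) → b ≢ 0ℤ →
    ∀ (u : ℤ → ℚ) → IsLRBS u → IsSimple u → (∀ n → u n ∈ℤ[1/ b ]) →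
    (¬ HasIntegerZero u) ⇔
    (∃[ N ] 1 ≤ N ×
    (∃[ t ] Σ[ p ∈ (Fin t → ℕ) ]
    (∀ i → Prime (p i) × gcd b (+ (p i)) ≡ 1ℤ) ×
    (∀ (ℓ : Fin N) → ∃[ i ] ¬ HasPadicZero (p i) (λ n → u (+ N * n + + toℕ ℓ))))))
mainTheorem6 em = mk⇔
  (λ skolem b b≢0 u lrbs@(R , holds) simple u∈ → mk⇔
    (λ ¬zero →
      -- The conjecture is applied over `c`, which makes the recurrence reversible; primes prime to
      -- `c` are also prime to its divisor `b`.
      let c , c≢0 , b∣c , reversible = ∃-reversibleOver R b≢0
          u∈′ = λ n → ∈-∣ b∣c (u∈ n)
      in modular⇒padic R holds reversible b∣c u∈′
           (Equivalence.to (skolem c c≢0 u lrbs simple u∈′) ¬zero))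
    (padic⇒¬integerZero b))
  (λ S′ b b≢0 u lrbs simple u∈ → mk⇔
    -- The same `b` serves on both sides; excluded middle enters through the compactness of ℤₚ.
    (λ ¬zero → padic⇒modular em (Equivalence.to (S′ b b≢0 u lrbs simple u∈) ¬zero))
    modular⇒¬integerZero)
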